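{- Let $\{\alpha_1,\dots,\alpha_N\}$ be a set of finite equivalent algorithms on a countable task set $\Omega$, with execution time functions $\pi_{\alpha_1},\dots,\pi_{\alpha_N}$, such that no $\alpha_n$ dominates $\{\alpha_1,\dots,\alpha_N\}$. Suppose there is a probability space $(\Omega,\mathcal F,P)$ over $\Omega$ such that $\pi_{\alpha_1},\dots,\pi_{\alpha_N}$ are random variables, and let $f_{\pi_{\alpha_1},\dots,\pi_{\alpha_N}}:\mathbb R^N\to\mathbb R$ be their joint density. Let $(\tau_1,\dots,\tau_{N-1})\in[0,\infty)^{N-1}$, and let $T=T_{\pi_{\alpha_1},\dots,\pi_{\alpha_N}}(\tau_1,\dots,\tau_{N-1})$ be the execution time of the derived algorithm and $S_1,\dots,S_{N-1}$ the associated events (as defined in the context). Then the expected value of $T$, if it exists, is $$E\,T=E(\pi_{\alpha_1}\mid\Omega\setminus S_1)\,P(\Omega\setminus S_1)+\sum_{n=2}^{N-1}E(\pi_{\alpha_n}\mid S_{n-1}\setminus S_n)\,P(S_{n-1}\setminus S_n)+E(\pi_{\alpha_N}\mid S_{N-1})\,P(S_{N-1})+\sum_{n=1}^{N-1}\tau_n P(S_n).$$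
   Context: An algorithm $\alpha$ is a pair $(\rho_\alpha,\pi_\alpha)$, where $\rho_\alpha:\Omega\to\Gamma$ is a Turing-computable map from a countable set $\Omega$ (tasks) to a countable set $\Gamma$ (outputs), and $\pi_\alpha$ maps $\Omega$ into the positive reals; $\pi_\alpha(\omega)$ is the execution time on task $\omega$. The algorithm is finite if $0<\pi_\alpha(\omega)<\infty$ for all $\omega\in\Omega$. Two algorithms are equivalent if their output functions $\rho$ have the same domain and agree at every $\omega\in\Omega$. For a set $\{\alpha_1,\dots,\alpha_N\}$ of equivalent algorithms, $\alpha_n$ dominates the set if $\pi_{\alpha_n}(\omega)\le\pi_{\alpha_i}(\omega)$ for every $\omega\in\Omega$ and every $i\in\{1,\dots,N\}$. For $1\le n\le N-1$ put $$S_n=\{\omega\in\Omega:\ \tau_1<\pi_{\alpha_1}(\omega),\ \tau_2<\pi_{\alpha_2}(\omega),\ \dots,\ \tau_n<\pi_{\alpha_n}(\omega)\}.$$ The execution time of the derived algorithm (which runs $\alpha_1$ for time at most $\tau_1$, then if unfinished abandons it and runs $\alpha_2$ for time at most $\tau_2$, and so on, with $\alpha_N$ finally run without time limit) is the random variable $T:\Omega\to\mathbb R$ given by - $T(\omega)=\pi_{\alpha_1}(\omega)$ for $\omega\in\Omega\setminus S_1$; - $T(\omega)=\tau_1+\dots+\tau_{n-1}+\pi_{\alpha_n}(\omega)$ for $\omega\in S_{n-1}\setminus S_n$, $2\le n\le N-1$; - $T(\omega)=\tau_1+\dots+\tau_{N-1}+\pi_{\alpha_N}(\omega)$ for $\omega\in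 S_{N-1}$. For an event $A$, $E(X\mid A)$ is the conditional expectation of $X$ given $A$; a product $E(X\mid A)P(A)$ is read as $0$ if $P(A)=0$. Empty sums are $0$. -}

module Defs where

open import Algebra.Bundles using (CommutativeRing)
import Algebra.Construct.NaturalChoice.Max as Max
import Algebra.Properties.Monoid.Sum as Sum
open import Data.Empty using (⊥)
open import Data.Fin.Base as Fin using (Fin; zero; suc; toℕ; fromℕ; inject; inject₁; Fin′)
open import Data.List.Base using (List; []; _∷_; replicate)
open import Data.Maybe.Base using (Maybe; just; nothing)
open import Data.Nat.Base as ℕ using (ℕ; zero; suc)
open import Data.Product.Base using (Σ-syntax; ∃; ∃-syntax; _×_; _,_)
open import Data.Unit.Base using (⊤)
open import Data.Vec.Functional using (Vector; foldr)
open import Function.Bundles using (_↣_; Injection)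
open import Level using (0ℓ; Level) renaming (suc to lsuc)
open import Relation.Binary.Bundles using (TotalOrder)
open import Relation.Binary.PropositionalEquality.Core using (_≡_; _≢_)
open import Relation.Binary.Structures using (IsTotalOrder)
import Relation.Binary.Construct.NonStrictToStrict as ToStrict
open import Relation.Nullary.Negation.Core using (¬_)
open import Relation.Unary using (Pred; U; ∅; ∁; _∩_; _∖_; _∈_; _≐_; ⋃; _⊢_; Empty; Satisfiable)

1ℓ : Level
1ℓ = lsuc 0ℓ

-- Turing machines with a two-way infinite tape.  A machine halts when its
-- transition function is undefined.  Numbers are written in unary.

data Move : Set where
  L R : Move

record TuringMachine : Set where
  field
    #states #symbols : ℕ

  State : Set
  State = Fin (suc #states)

  Symbol : Set
  Symbol = Fin (suc (suc #symbols))

  field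
    δ : State → Symbol → Maybe (State × Symbol × Move)

  blank mark : Symbol
  blank = zero
  mark  = suc zero

module Execution (M : TuringMachine) where

  open TuringMachine M

  -- The two halves of the tape are listed outwards from the head;
  -- cells beyond the end of a list are blank.
  record Config : Set where
    constructor config
    field
      state : State
      left  : List Symbol
      head  : Symbol
      right : List Symbol

  move : Move → State → List Symbol → Symbol → List Symbol → Config
  move L q []       a rs       = config q [] blank (a ∷ rs)
  move L q (l ∷ ls) a rs       = config q ls l (a ∷ rs)
  move R q ls       a []       = config q (a ∷ ls) blank []
  move R q ls       a (r ∷ rs) = config q (a ∷ ls) r rs

  step : Config → Maybe Config
  step (config q ls a rs) with δ q a
  ... | nothing           = nothing
  ... | just (q′ , b , d) = just (move d q′ ls b rs)

  data _⇓_ : Config → Config → Set where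
    halt : ∀ {c} → step c ≡ nothing → c ⇓ c
    next : ∀ {c d e} → step c ≡ just d → d ⇓ e → c ⇓ e

  -- Input: a blank under the head, followed on its right by n marks.
  initial : ℕ → Config
  initial n = config zero [] blank (replicate n mark)

  leadingMarks : List Symbol → ℕ
  leadingMarks (suc zero ∷ as) = suc (leadingMarks as)
  leadingMarks _               = zero

  output : Config → ℕ
  output c = leadingMarks (Config.right c)

  Computes : ℕ → ℕ → Set
  Computes m n = ∃[ c ] initial m ⇓ c × output c ≡ n

-- A countable set comes with an injective coding by natural numbers, through
-- which its elements are given to and returned by Turing machines.
TuringComputable : {Ω Γ : Set} → Ω ↣ ℕ → Γ ↣ ℕ → (Ω → Γ) → Set
TuringComputable codeΩ codeΓ ρ =
  Σ[ M ∈ TuringMachine ] (∀ ω →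
    Execution.Computes M (Injection.to codeΩ ω) (Injection.to codeΓ (ρ ω)))

-- The real numbers, axiomatised (up to isomorphism, classically) as a Dedekind
-- complete ordered field.

record CompleteOrderedField : Set (lsuc 1ℓ) where
  infix 4 _≤_
  field
    commutativeRing : CommutativeRing 0ℓ 0ℓ

  open CommutativeRing commutativeRing public hiding (zero)

  field
    _≤_          : Carrier → Carrier → Set
    isTotalOrder : IsTotalOrder _≈_ _≤_
    +-monoʳ-≤    : ∀ z {x y} → x ≤ y → z + x ≤ z + y
    *-nonneg     : ∀ {x y} → 0# ≤ x → 0# ≤ y → 0# ≤ x * y
    0≉1          : ¬ (0# ≈ 1#)
    inv          : ∀ x → ¬ (x ≈ 0#) → Carrier
    *-inverseʳ   : ∀ x (x≉0 : ¬ (x ≈ 0#)) → x * inv x x≉0 ≈ 1#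

  UpperBound : Pred Carrier 1ℓ → Carrier → Set 1ℓ
  UpperBound A u = ∀ {x} → x ∈ A → x ≤ u

  field
    complete : (A : Pred Carrier 1ℓ) → Satisfiable A → ∃ (UpperBound A) →
               ∃[ s ] UpperBound A s × (∀ {u} → UpperBound A u → s ≤ u)

  totalOrder : TotalOrder 0ℓ 0ℓ 0ℓ
  totalOrder = record { isTotalOrder = isTotalOrder }

  open ToStrict _≈_ _≤_ public using (_<_)
  open Max totalOrder public using (_⊔_)
  open Sum +-monoid public using (sum; sum-syntax)

-- Events form a predicate on subsets; subsets with the same elements are
-- identified.

record IsσAlgebra {X : Set} (F : Pred (Pred X 0ℓ) 1ℓ) : Set 1ℓ where
  field
    resp       : ∀ {A B} → A ≐ B → F A → F B
    universe   : F U
    complement : ∀ {A} → F A → F (∁ A)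
    union      : ∀ {A : ℕ → Pred X 0ℓ} → (∀ n → F (A n)) → F (⋃[ n ∶ ℕ ] A n)

data Generated {X : Set} (G : Pred (Pred X 0ℓ) 0ℓ) : Pred (Pred X 0ℓ) 1ℓ where
  generator  : ∀ {A} → G A → Generated G A
  resp       : ∀ {A B} → A ≐ B → Generated G A → Generated G B
  universe   : Generated G U
  complement : ∀ {A} → Generated G A → Generated G (∁ A)
  union      : ∀ {A : ℕ → Pred X 0ℓ} → (∀ n → Generated G (A n)) →
               Generated G (⋃[ n ∶ ℕ ] A n)

module Probability (ℝ : CompleteOrderedField) where

  open CompleteOrderedField ℝ

  infix  4 _≤∞_ _<∞_
  infixl 6 _+∞_
  infixl 7 _·∞_

  -- Extended reals without -∞.
  data ℝ∞ : Set where
    fin : Carrier → ℝ∞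
    ∞   : ℝ∞

  _≤∞_ : ℝ∞ → ℝ∞ → Set
  fin x ≤∞ fin y = x ≤ y
  _     ≤∞ ∞     = ⊤
  ∞     ≤∞ fin _ = ⊥

  _<∞_ : ℝ∞ → ℝ∞ → Set
  fin x <∞ fin y = x < y
  fin _ <∞ ∞     = ⊤
  ∞     <∞ _     = ⊥

  _+∞_ : ℝ∞ → ℝ∞ → ℝ∞
  fin x +∞ fin y = fin (x + y)
  fin _ +∞ ∞     = ∞
  ∞     +∞ _     = ∞

  -- Used only for a scalar > 0, so that c · ∞ = ∞ is right.
  _·∞_ : Carrier → ℝ∞ → ℝ∞
  c ·∞ fin x = fin (c * x)
  c ·∞ ∞     = ∞

  sum∞ : ∀ {n} → Vector ℝ∞ n → ℝ∞
  sum∞ = foldr _+∞_ (fin 0#)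

  IsSup : ∀ {i} {I : Set i} → (I → ℝ∞) → ℝ∞ → Set i
  IsSup f s = (∀ i → f i ≤∞ s) × (∀ u → (∀ i → f i ≤∞ u) → s ≤∞ u)

  -- The sum of a series of nonnegative terms.
  HasSum : (ℕ → ℝ∞) → ℝ∞ → Set
  HasSum a = IsSup (λ n → sum∞ {n} (λ i → a (toℕ i)))

  Disjoint : {X I : Set} → (I → Pred X 0ℓ) → Set
  Disjoint A = ∀ {i j} → i ≢ j → Empty (A i ∩ A j)

  -- Set functions are total, but nothing is required of them, and they are
  -- never used, outside the σ-algebra F.
  record IsMeasure {X : Set} (F : Pred (Pred X 0ℓ) 1ℓ) (μ : Pred X 0ℓ → ℝ∞) : Set 1ℓ where
    field
      isσAlgebra : IsσAlgebra F
      cong       : ∀ {A B} → F A → A ≐ B → μ A ≤∞ μ B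
      nonneg     : ∀ {A} → F A → fin 0# ≤∞ μ A
      empty      : μ ∅ ≤∞ fin 0#
      additive   : ∀ {A : ℕ → Pred X 0ℓ} → (∀ n → F (A n)) → Disjoint A →
                   HasSum (λ n → μ (A n)) (μ (⋃[ n ∶ ℕ ] A n))

  record ProbabilitySpace (Ω : Set) : Set (lsuc 1ℓ) where
    field
      F         : Pred (Pred Ω 0ℓ) 1ℓ
      P         : Pred Ω 0ℓ → Carrier
      isMeasure : IsMeasure F (λ A → fin (P A))
      total     : P U ≈ 1#

  Openℝ : Pred (Pred Carrier 0ℓ) 0ℓ
  Openℝ A = ∀ {x} → x ∈ A → ∃[ ε ] 0# < ε ×
    (∀ y → x - ε < y → y < x + ε → y ∈ A)

  Openℝ^ : ∀ N → Pred (Pred (Vector Carrier N) 0ℓ) 0ℓ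
  Openℝ^ N A = ∀ {x} → x ∈ A → ∃[ ε ] 0# < ε ×
    (∀ y → (∀ i → x i - ε < y i × y i < x i + ε) → y ∈ A)

  Borelℝ : Pred (Pred Carrier 0ℓ) 1ℓ
  Borelℝ = Generated Openℝ

  Borelℝ^ : ∀ N → Pred (Pred (Vector Carrier N) 0ℓ) 1ℓ
  Borelℝ^ N = Generated (Openℝ^ N)

  Measurable : {X : Set} → Pred (Pred X 0ℓ) 1ℓ → (X → Carrier) → Set 1ℓ
  Measurable F f = ∀ {B} → Borelℝ B → F (f ⊢ B)

  -- A simple function Σᵢ cᵢ 1_{Aᵢ} ≤ f, for f ≥ 0, in the normal form with
  -- disjoint Aᵢ and cᵢ > 0.
  record SimpleBelow {X : Set} (F : Pred (Pred X 0ℓ) 1ℓ) (f : X → Carrier) : Set 1ℓ where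
    field
      size       : ℕ
      part       : Fin size → Pred X 0ℓ
      measurable : ∀ i → F (part i)
      disjoint   : Disjoint part
      coeff      : Fin size → Carrier
      positive   : ∀ i → 0# < coeff i
      below      : ∀ i {x} → x ∈ part i → coeff i ≤ f x

    value : (Pred X 0ℓ → ℝ∞) → ℝ∞
    value μ = sum∞ (λ i → coeff i ·∞ μ (part i))

  -- v is the Lebesgue integral of the measurable function f ≥ 0.
  Integral⁺ : {X : Set} → Pred (Pred X 0ℓ) 1ℓ → (Pred X 0ℓ → ℝ∞) → (X → Carrier) → ℝ∞ → Set 1ℓ
  Integral⁺ F μ f v = IsSup {I = SimpleBelow F f} (λ s → SimpleBelow.value s μ) v

  -- The expected value of the random variable X with respect to a probability
  -- Q on F exists (as a real number) and equals e.
  Expectation : {Ω : Set} → Pred (Pred Ω 0ℓ) 1ℓ → (Pred Ω 0ℓ → Carrier) → (Ω → Carrier) → Carrier → Set 1ℓ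
  Expectation F Q X e = ∃[ p ] ∃[ q ]
    Integral⁺ F (λ A → fin (Q A)) (λ ω → X ω ⊔ 0#) (fin p) ×
    Integral⁺ F (λ A → fin (Q A)) (λ ω → (- X ω) ⊔ 0#) (fin q) ×
    e ≈ p - q

  module _ {Ω : Set} (𝓟 : ProbabilitySpace Ω) where

    open ProbabilitySpace 𝓟

    condProb : (A : Pred Ω 0ℓ) → ¬ (P A ≈ 0#) → Pred Ω 0ℓ → Carrier
    condProb A PA≉0 B = P (B ∩ A) * inv (P A) PA≉0

    CondExpectation : (Ω → Carrier) → (A : Pred Ω 0ℓ) → ¬ (P A ≈ 0#) → Carrier → Set 1ℓ
    CondExpectation X A PA≉0 = Expectation F (condProb A PA≉0) X

    -- v is the product E(X ∣ A) P(A), which is 0 by convention if P(A) = 0.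
    data CondProduct (X : Ω → Carrier) (A : Pred Ω 0ℓ) (v : Carrier) : Set 1ℓ where
      null    : P A ≈ 0# → v ≈ 0# → CondProduct X A v
      nonnull : ∀ {e} (PA≉0 : ¬ (P A ≈ 0#)) → CondExpectation X A PA≉0 e →
                v ≈ e * P A → CondProduct X A v

    -- f is a joint density of X₁, …, X_N relative to the reference measure μ:
    -- P((X₁, …, X_N) ∈ B) = ∫_B f dμ for all Borel sets B.
    record IsJointDensity {N : ℕ} (X : Fin N → Ω → Carrier)
                          (μ : Pred (Vector Carrier N) 0ℓ → ℝ∞)
                          (f : Vector Carrier N → Carrier) : Set 1ℓ where
      field
        measurable : Measurable (Borelℝ^ N) f
        nonneg     : ∀ x → 0# ≤ f x
        density    : ∀ {B} → Borelℝ^ N B →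
          Integral⁺ (Borelℝ^ N) (λ A → μ (A ∩ B)) f (fin (P (λ ω → (λ n → X n ω) ∈ B)))

module Algorithms (ℝ : CompleteOrderedField) where

  open CompleteOrderedField ℝ
  open Probability ℝ

  record Algorithm {Ω Γ : Set} (codeΩ : Ω ↣ ℕ) (codeΓ : Γ ↣ ℕ) : Set where
    field
      ρ            : Ω → Γ
      ρ-computable : TuringComputable codeΩ codeΓ ρ
      π            : Ω → Carrier
      π-positive   : ∀ ω → 0# < π ω

  open Algorithm public

  module _ {Ω Γ : Set} {codeΩ : Ω ↣ ℕ} {codeΓ : Γ ↣ ℕ} where

    Finite : Algorithm codeΩ codeΓ → Set
    Finite α = ∀ ω → fin 0# <∞ fin (π α ω) × fin (π α ω) <∞ ∞

    Equivalent : Algorithm codeΩ codeΓ → Algorithm codeΩ codeΓ → Set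
    Equivalent α β = ∀ ω → ρ α ω ≡ ρ β ω

    Dominates : ∀ {N} → (Fin N → Algorithm codeΩ codeΓ) → Fin N → Set
    Dominates α n = ∀ ω i → π (α n) ω ≤ π (α i) ω

  -- Times π₁, …, π_N and limits τ₁, …, τ_{N-1}, numbered from zero, where
  -- N = 2 + m: a single algorithm dominates itself, so N ≥ 2 below.
  module _ {Ω : Set} {m : ℕ} (π : Fin (2 ℕ.+ m) → Ω → Carrier) (τ : Fin (1 ℕ.+ m) → Carrier) where

    S : Fin (1 ℕ.+ m) → Pred Ω 0ℓ
    S n ω = ∀ i → i Fin.≤ n → τ i < π (inject₁ i) ω

    -- In the middle clause, n stands for the one-based index n + 2, running
    -- over 2, …, N - 1; the sum is over all limits preceding that index.
    record IsDerivedTime (T : Ω → Carrier) : Set where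
      field
        first  : ∀ {ω} → ω ∈ ∁ (S zero) → T ω ≈ π zero ω
        middle : ∀ (n : Fin m) {ω} → ω ∈ S (inject₁ n) ∖ S (suc n) →
                 T ω ≈ sum (λ (i : Fin′ (suc n)) → τ (inject i)) + π (inject₁ (suc n)) ω
        last   : ∀ {ω} → ω ∈ S (fromℕ m) → T ω ≈ sum τ + π (fromℕ (suc m)) ω

{-# OPTIONS --safe #-}
-- The events ∁ S₁, S₁ ∖ S₂, …, S_{N-1} partition Ω, and on S_n the derived time
-- exceeds the derived time of the algorithms after the n-th by the constant
-- τ₁ + … + τ_n.  So E T is computed by peeling off one algorithm at a time:
-- ∫_D T = ∫_{D ∖ S₁} π₁ + τ₁ P(S₁) + ∫_{S₁} T′, where T′ = T - τ₁ is the derived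
-- time of the remaining algorithms.  Both rules for the integral used here,
-- additivity in the set and translation by a constant, hold for the supremum over
-- simple functions by direct manipulation of simple functions, without convergence
-- theorems and without measurability of the integrand.
module Submission where

open import Defs
open import Axiom.ExcludedMiddle using (ExcludedMiddle)
import Algebra.Construct.NaturalChoice.Max as Max
import Algebra.Properties.AbelianGroup as AbelianGroupProperties
import Algebra.Properties.CommutativeMonoid.Sum as CommutativeMonoidSum
import Algebra.Properties.CommutativeSemigroup as CommutativeSemigroupProperties
import Algebra.Properties.Ring as RingProperties
import Algebra.Properties.Semiring.Sum as SemiringSum
open import Data.Empty using (⊥)
open import Data.Fin.Base as Fin using (Fin; zero; suc; fromℕ; inject₁; inject; Fin′; splitAt; join)
import Data.Fin.Properties as Finₚ
open import Data.Nat.Base as ℕ using (ℕ; zero; suc)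
import Data.Nat.Properties as ℕₚ
open import Data.Product.Base using (Σ-syntax; ∃; ∃-syntax; _×_; _,_; proj₁; proj₂)
open import Data.Sum.Base using (_⊎_; inj₁; inj₂; [_,_]; [_,_]′)
open import Data.Unit.Base using (tt)
open import Data.Vec.Functional using (Vector)
open import Function.Base using (_∘_; id)
open import Function.Bundles using (_↣_)
open import Level using (0ℓ; Lift; lift; lower)
open import Relation.Binary.Bundles using (TotalOrder)
open import Relation.Binary.PropositionalEquality as ≡ using (_≡_; _≢_)
import Relation.Binary.Construct.NonStrictToStrict as ToStrict
import Relation.Binary.Reasoning.PartialOrder as PartialOrderReasoning
open import Relation.Nullary.Decidable using (Dec; yes; no; map′)
open import Relation.Nullary.Negation.Core using (¬_; contradiction)
open import Relation.Unary using (Pred; U; ∅; ∁; _∩_; _∪_; _∖_; _⊆_; _≐_; ⋃)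

-- Order arithmetic, finite sums and suprema in a complete ordered field.

module OrderedField (ℝ : CompleteOrderedField) where

  open CompleteOrderedField ℝ public
  open TotalOrder totalOrder public
    using (poset; total; antisym; ≤-respˡ-≈; ≤-respʳ-≈)
    renaming (refl to ≤-refl; reflexive to ≤-reflexive; trans to ≤-trans)
  open Max totalOrder public using (x≤y⇒y⊔x≈y; x≤y⇒x⊔y≈y)
  open AbelianGroupProperties +-abelianGroup public
    using (//-rightDividesˡ; //-rightDividesʳ)
    renaming (⁻¹-involutive to -‿involutive; ε⁻¹≈ε to -0≈0)
  open RingProperties ring public using (-‿distribˡ-*; -‿distribʳ-*)
  open CommutativeMonoidSum +-commutativeMonoid public
    using (∑-distrib-+; sum-cong-≋; sum-replicate-zero)
  open SemiringSum semiring public using (*-distribˡ-sum)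
  open CommutativeSemigroupProperties *-commutativeSemigroup public
    using () renaming (x∙yz≈y∙xz to x*yz≈y*xz)
  module ≤-Reasoning = PartialOrderReasoning poset
  open ≤-Reasoning

  +-monoˡ-≤ : ∀ z {x y} → x ≤ y → x + z ≤ y + z
  +-monoˡ-≤ z {x} {y} x≤y = begin
    x + z  ≈⟨ +-comm x z ⟩
    z + x  ≤⟨ +-monoʳ-≤ z x≤y ⟩
    z + y  ≈⟨ +-comm z y ⟩
    y + z  ∎

  +-mono-≤ : ∀ {x y u v} → x ≤ y → u ≤ v → x + u ≤ y + v
  +-mono-≤ {y = y} {u} x≤y u≤v = ≤-trans (+-monoˡ-≤ u x≤y) (+-monoʳ-≤ y u≤v)

  x+y≤z⇒x≤z-y : ∀ {x y z} → x + y ≤ z → x ≤ z - y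
  x+y≤z⇒x≤z-y {x} {y} {z} p = begin
    x          ≈⟨ //-rightDividesʳ y x ⟨
    x + y - y  ≤⟨ +-monoˡ-≤ (- y) p ⟩
    z - y      ∎

  x≤z-y⇒x+y≤z : ∀ {x y z} → x ≤ z - y → x + y ≤ z
  x≤z-y⇒x+y≤z {x} {y} {z} p = begin
    x + y      ≤⟨ +-monoˡ-≤ y p ⟩
    z - y + y  ≈⟨ //-rightDividesˡ y z ⟩
    z          ∎

  x≤y+z⇒x-z≤y : ∀ {x y z} → x ≤ y + z → x - z ≤ y
  x≤y+z⇒x-z≤y {x} {y} {z} p = begin
    x - z      ≤⟨ +-monoˡ-≤ (- z) p ⟩
    y + z - z  ≈⟨ //-rightDividesʳ z y ⟩
    y          ∎

  x≤x+y : ∀ {x y} → 0# ≤ y → x ≤ x + y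
  x≤x+y {x} {y} 0≤y = begin
    x       ≈⟨ +-identityʳ x ⟨
    x + 0#  ≤⟨ +-monoʳ-≤ x 0≤y ⟩
    x + y   ∎

  x≤y⇒0≤y-x : ∀ {x y} → x ≤ y → 0# ≤ y - x
  x≤y⇒0≤y-x x≤y = x+y≤z⇒x≤z-y (≤-respˡ-≈ (sym (+-identityˡ _)) x≤y)

  0≤x⇒-x≤0 : ∀ {x} → 0# ≤ x → - x ≤ 0#
  0≤x⇒-x≤0 0≤x = ≤-respˡ-≈ (+-identityˡ _) (x≤y+z⇒x-z≤y (≤-respʳ-≈ (sym (+-identityˡ _)) 0≤x))

  x≤0⇒0≤-x : ∀ {x} → x ≤ 0# → 0# ≤ - x
  x≤0⇒0≤-x x≤0 = ≤-respʳ-≈ (+-identityˡ _) (x≤y⇒0≤y-x x≤0)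

  +-nonneg : ∀ {x y} → 0# ≤ x → 0# ≤ y → 0# ≤ x + y
  +-nonneg 0≤x 0≤y = ≤-trans 0≤x (x≤x+y 0≤y)

  *-monoʳ-≤ : ∀ {z x y} → 0# ≤ z → x ≤ y → z * x ≤ z * y
  *-monoʳ-≤ {z} {x} {y} 0≤z x≤y = begin
    z * x                ≈⟨ +-identityˡ _ ⟨
    0# + z * x           ≤⟨ +-monoˡ-≤ (z * x) (*-nonneg 0≤z (x≤y⇒0≤y-x x≤y)) ⟩
    z * (y - x) + z * x  ≈⟨ distribˡ z (y - x) x ⟨
    z * (y - x + x)      ≈⟨ *-congˡ (//-rightDividesˡ x y) ⟩
    z * y                ∎

  square-nonneg : ∀ x → 0# ≤ x * x
  square-nonneg x with total 0# x
  ... | inj₁ 0≤x = *-nonneg 0≤x 0≤x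
  ... | inj₂ x≤0 = begin
    0#           ≤⟨ *-nonneg (x≤0⇒0≤-x x≤0) (x≤0⇒0≤-x x≤0) ⟩
    - x * - x    ≈⟨ -‿distribˡ-* x (- x) ⟨
    - (x * - x)  ≈⟨ -‿cong (-‿distribʳ-* x x) ⟨
    - - (x * x)  ≈⟨ -‿involutive (x * x) ⟩
    x * x        ∎

  -- The inverse y of x is x y².
  inverse-nonneg : ∀ {x y} → 0# ≤ x → x * y ≈ 1# → 0# ≤ y
  inverse-nonneg {x} {y} 0≤x xy≈1 = begin
    0#           ≤⟨ *-nonneg 0≤x (square-nonneg y) ⟩
    x * (y * y)  ≈⟨ *-assoc x y y ⟨
    x * y * y    ≈⟨ *-congʳ xy≈1 ⟩
    1# * y       ≈⟨ *-identityˡ y ⟩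
    y            ∎

  <-≤-trans : ∀ {x y z} → x < y → y ≤ z → x < z
  <-≤-trans = ToStrict.<-≤-trans _≈_ _≤_ sym ≤-trans antisym ≤-respʳ-≈

  x<y⇒0<y-x : ∀ {x y} → x < y → 0# < y - x
  x<y⇒0<y-x {x} {y} (x≤y , x≉y) = x≤y⇒0≤y-x x≤y , λ 0≈y-x → x≉y (begin-equality
    x          ≈⟨ +-identityˡ x ⟨
    0# + x     ≈⟨ +-congʳ 0≈y-x ⟩
    y - x + x  ≈⟨ //-rightDividesˡ x y ⟩
    y          ∎)

  x-[x-y]≈y : ∀ x y → x - (x - y) ≈ y
  x-[x-y]≈y x y = begin-equality
    x - (x - y)            ≈⟨ +-congʳ (//-rightDividesˡ y x) ⟨
    x - y + y - (x - y)    ≈⟨ +-congʳ (+-comm (x - y) y) ⟩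
    y + (x - y) - (x - y)  ≈⟨ //-rightDividesʳ (x - y) y ⟩
    y                      ∎

  sum-mono-≤ : ∀ {n} {f g : Vector Carrier n} → (∀ i → f i ≤ g i) → sum f ≤ sum g
  sum-mono-≤ {zero}  f≤g = ≤-refl
  sum-mono-≤ {suc n} f≤g = +-mono-≤ (f≤g zero) (sum-mono-≤ (f≤g ∘ suc))

  sum-zero : ∀ {n} {f : Vector Carrier n} → (∀ i → f i ≈ 0#) → sum f ≈ 0#
  sum-zero {n} f≈0 = trans (sum-cong-≋ f≈0) (sum-replicate-zero n)

  -- Taking `h` on the disjoint sum lets the induction absorb `suc` into the left injection.
  sum-splitAt : ∀ m {n} (h : Fin m ⊎ Fin n → Carrier) →
                sum (h ∘ splitAt m) ≈ sum (h ∘ inj₁) + sum (h ∘ inj₂)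
  sum-splitAt zero    h = sym (+-identityˡ _)
  sum-splitAt (suc m) h = trans
    (+-congˡ (sum-splitAt m (h ∘ [ inj₁ ∘ suc , inj₂ ]′ )))
    (sym (+-assoc _ _ _))

  -- The form of `IsSup` for real values, with real upper bounds only. The index type is in `Set 1ℓ`
  -- because it will be a type of simple functions.
  IsLub : {I : Set 1ℓ} → (I → Carrier) → Carrier → Set 1ℓ
  IsLub f v = (∀ i → f i ≤ v) × (∀ u → (∀ i → f i ≤ u) → v ≤ u)

  lub-exists : {I : Set 1ℓ} (f : I → Carrier) → I → ∀ u → (∀ i → f i ≤ u) → ∃ (IsLub f)
  lub-exists f i₀ u f≤u
    with complete (λ x → ∃[ i ] x ≈ f i) (f i₀ , i₀ , refl)
                  (u , λ { (i , x≈) → ≤-respˡ-≈ (sym x≈) (f≤u i) })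
  ... | s , upper , least = s , (λ i → upper (i , refl)) ,
    λ w f≤w → least λ { (i , x≈) → ≤-respˡ-≈ (sym x≈) (f≤w i) }

  lub-cong : {I : Set 1ℓ} {f g : I → Carrier} {v : Carrier} →
             (∀ i → f i ≈ g i) → IsLub f v → IsLub g v
  lub-cong f≈g (upper , least) =
    (λ i → ≤-respˡ-≈ (f≈g i) (upper i)) ,
    λ u g≤u → least u λ i → ≤-respˡ-≈ (sym (f≈g i)) (g≤u i)

  lub-zero : {I : Set 1ℓ} {f : I → Carrier} {v : Carrier} →
             I → (∀ i → f i ≈ 0#) → IsLub f v → v ≈ 0#
  lub-zero i₀ f≈0 (upper , least) = antisym
    (least 0# (≤-reflexive ∘ f≈0)) (≤-respˡ-≈ (f≈0 i₀) (upper i₀))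

  -- Multiplication by `r` is an order isomorphism with inverse multiplication by `s`, so it carries
  -- suprema to suprema.
  lub-scale : {I : Set 1ℓ} {f : I → Carrier} {v r s : Carrier} → 0# ≤ r → 0# ≤ s → s * r ≈ 1# →
              IsLub f v → IsLub (λ i → r * f i) (r * v)
  lub-scale {f = f} {v} {r} {s} 0≤r 0≤s sr≈1 (upper , least) =
    (λ i → *-monoʳ-≤ 0≤r (upper i)) , λ u rf≤u → begin
      r * v        ≤⟨ *-monoʳ-≤ 0≤r (least (s * u) λ i → begin
        f i            ≈⟨ cancel s r (f i) sr≈1 ⟨
        s * (r * f i)  ≤⟨ *-monoʳ-≤ 0≤s (rf≤u i) ⟩
        s * u          ∎) ⟩
      r * (s * u)  ≈⟨ cancel r s u (trans (*-comm r s) sr≈1) ⟩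
      u            ∎
    where
    cancel : ∀ a b x → a * b ≈ 1# → a * (b * x) ≈ x
    cancel a b x ab≈1 = trans (sym (*-assoc a b x)) (trans (*-congʳ ab≈1) (*-identityˡ x))

-- Closure properties of events and finite additivity of probability.

module Events (em : ExcludedMiddle 1ℓ) (ℝ : CompleteOrderedField) {Ω : Set}
              (𝓟 : Probability.ProbabilitySpace ℝ Ω) where

  open OrderedField ℝ public
  open Probability ℝ public
  open ProbabilitySpace 𝓟 public using (F; P; isMeasure)
  open IsMeasure isMeasure using (isσAlgebra; additive; empty; nonneg) renaming (cong to μ-cong)
  open IsσAlgebra isσAlgebra public
    renaming (resp to F-resp; universe to F-U; complement to F-∁; union to F-⋃)
  open ≤-Reasoning

  decide : (A : Set) → Dec A
  decide A = map′ lower lift (em {Lift 1ℓ A})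

  ≮⇒≥ : ∀ {x y} → ¬ (x < y) → y ≤ x
  ≮⇒≥ = ToStrict.≮⇒≥ _≈_ _≤_ sym (λ x y → decide (x ≈ y)) ≤-reflexive total

  F-∅ : F ∅
  F-∅ = F-resp ((λ ¬u → ¬u tt) , λ ()) (F-∁ F-U)

  F-∪ : ∀ {A B} → F A → F B → F (A ∪ B)
  F-∪ {A} {B} FA FB = F-resp
    ((λ { (zero , a) → inj₁ a ; (suc _ , b) → inj₂ b }) ,
     λ { (inj₁ a) → zero , a ; (inj₂ b) → 1 , b })
    (F-⋃ {seq} λ { zero → FA ; (suc _) → FB })
    where
    -- The binary union is the countable union of A, B, B, ....
    seq : ℕ → Pred Ω 0ℓ
    seq zero    = A
    seq (suc _) = B

  F-∩ : ∀ {A B} → F A → F B → F (A ∩ B)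
  F-∩ {A} {B} FA FB = F-resp (to , from) (F-∁ (F-∪ (F-∁ FA) (F-∁ FB)))
    where
    to : ∁ (∁ A ∪ ∁ B) ⊆ A ∩ B
    to {x} h with decide (A x) | decide (B x)
    ... | no ¬a | _     = contradiction (inj₁ ¬a) h
    ... | yes _ | no ¬b = contradiction (inj₂ ¬b) h
    ... | yes a | yes b = a , b
    from : A ∩ B ⊆ ∁ (∁ A ∪ ∁ B)
    from (a , b) = [ (λ ¬a → ¬a a) , (λ ¬b → ¬b b) ]

  F-∖ : ∀ {A B} → F A → F B → F (A ∖ B)
  F-∖ FA FB = F-∩ FA (F-∁ FB)

  F-∀ : ∀ {n} {A : Fin n → Pred Ω 0ℓ} → (∀ i → F (A i)) → F (λ x → ∀ i → A i x)
  F-∀ {zero}  FA = F-resp ((λ _ ()) , λ _ → tt) F-U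
  F-∀ {suc n} FA = F-resp
    ((λ { (a , as) zero → a ; (a , as) (suc i) → as i }) , λ as → as zero , as ∘ suc)
    (F-∩ (FA zero) (F-∀ (FA ∘ suc)))

  -- The premise `A` does not depend on the point, so the event is either `B` or the whole space.
  -- This handles the condition on indices in the definition of `S`.
  F-→ : ∀ {A : Set} {B : Pred Ω 0ℓ} → F B → F (λ x → A → B x)
  F-→ {A} FB with decide A
  ... | yes a = F-resp ((λ b _ → b) , λ b → b a) FB
  ... | no ¬a = F-resp ((λ _ a → contradiction a ¬a) , λ _ → tt) F-U

  F-∃ : ∀ {n} {A : Fin n → Pred Ω 0ℓ} → (∀ i → F (A i)) → F (λ x → ∃[ i ] A i x)
  F-∃ {zero}  FA = F-resp ((λ ()) , λ ()) F-∅
  F-∃ {suc n} FA = F-resp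
    ([ (zero ,_) , (λ { (i , a) → suc i , a }) ] ,
     λ { (zero , a) → inj₁ a ; (suc i , a) → inj₂ (i , a) })
    (F-∪ (FA zero) (F-∃ (FA ∘ suc)))

  P-cong : ∀ {A B} → F A → A ≐ B → P A ≈ P B
  P-cong FA A≐B@(A⊆B , B⊆A) = antisym (μ-cong FA A≐B) (μ-cong (F-resp A≐B FA) (B⊆A , A⊆B))

  P-nonneg : ∀ {A} → F A → 0# ≤ P A
  P-nonneg = nonneg

  P-∅ : ∀ {A} → F A → (∀ {x} → ¬ A x) → P A ≈ 0#
  P-∅ FA ¬A = trans (P-cong FA ((λ a → contradiction a ¬A) , λ ())) (antisym empty (nonneg F-∅))

  sum∞-fin : ∀ {n} (g : Vector Carrier n) → sum∞ (λ i → fin (g i)) ≡ fin (sum g)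
  sum∞-fin {zero}  g = ≡.refl
  sum∞-fin {suc n} g = ≡.cong (fin (g zero) +∞_) (sum∞-fin (g ∘ suc))

  record Partition (D A B : Pred Ω 0ℓ) : Set where
    field
      cover    : D ⊆ A ∪ B
      inˡ      : A ⊆ D
      inʳ      : B ⊆ D
      disjoint : ∀ {x} → A x → B x → ⊥

  open Partition public

  ∩-partition : ∀ C {D A B} → Partition D A B → Partition (C ∩ D) (C ∩ A) (C ∩ B)
  ∩-partition C p = record
    { cover    = λ { (c , d) → [ (λ a → inj₁ (c , a)) , (λ b → inj₂ (c , b)) ] (cover p d) }
    ; inˡ      = λ { (c , a) → c , inˡ p a }
    ; inʳ      = λ { (c , b) → c , inʳ p b }
    ; disjoint = λ { (_ , a) (_ , b) → disjoint p a b }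
    }

  ∩∖-partition : ∀ C A → Partition C (C ∩ A) (C ∖ A)
  ∩∖-partition C A = record
    { cover    = cover′
    ; inˡ      = proj₁
    ; inʳ      = proj₁
    ; disjoint = λ { (_ , a) (_ , ¬a) → ¬a a }
    }
    where
    cover′ : C ⊆ (C ∩ A) ∪ (C ∖ A)
    cover′ {x} c with decide (A x)
    ... | yes a = inj₁ (c , a)
    ... | no ¬a = inj₂ (c , ¬a)

  -- Countable additivity is applied to A, B, ∅, ∅, ...: every partial sum is at most `P A + P B`,
  -- and the one with two terms attains it.
  P-partition : ∀ {D A B} → F A → F B → Partition D A B → P D ≈ P A + P B
  P-partition {D} {A} {B} FA FB p = trans
    (P-cong (F-resp (to , from) (F-⋃ F-seq)) (from , to))
    (antisym (proj₂ hasSum (fin (P A + P B)) λ n → ≡.subst (_≤∞ fin (P A + P B)) (≡.sym (partial n)) (bound n))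
             (≤-respˡ-≈ (+-congˡ (+-identityʳ (P B))) (proj₁ hasSum 2)))
    where
    -- The padding is by ∅, since additivity asks for pairwise disjoint events.
    seq : ℕ → Pred Ω 0ℓ
    seq zero          = A
    seq (suc zero)    = B
    seq (suc (suc _)) = ∅

    F-seq : ∀ n → F (seq n)
    F-seq zero          = FA
    F-seq (suc zero)    = FB
    F-seq (suc (suc _)) = F-∅

    disjoint-seq : Disjoint seq
    disjoint-seq {zero}      {zero}      0≢0 _ _       = 0≢0 ≡.refl
    disjoint-seq {zero}      {suc zero}  _   _ (a , b) = disjoint p a b
    disjoint-seq {suc zero}  {zero}      _   _ (b , a) = disjoint p a b
    disjoint-seq {suc zero}  {suc zero}  1≢1 _ _       = 1≢1 ≡.refl
    disjoint-seq {suc (suc _)} {_} _ _ ()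
    disjoint-seq {zero}     {suc (suc _)} _ _ ()
    disjoint-seq {suc zero} {suc (suc _)} _ _ ()

    to : ⋃ ℕ seq ⊆ D
    to (zero , a)     = inˡ p a
    to (suc zero , b) = inʳ p b

    from : D ⊆ ⋃ ℕ seq
    from d with cover p d
    ... | inj₁ a = zero , a
    ... | inj₂ b = 1 , b

    hasSum : HasSum (λ n → fin (P (seq n))) (fin (P (⋃ ℕ seq)))
    hasSum = additive F-seq (λ {i} {j} → disjoint-seq {i} {j})

    partial : ∀ n → sum∞ {n} (λ i → fin (P (seq (Fin.toℕ i)))) ≡ fin (sum {n} (λ i → P (seq (Fin.toℕ i))))
    partial n = sum∞-fin {n} (λ i → P (seq (Fin.toℕ i)))

    bound : ∀ n → sum {n} (λ i → P (seq (Fin.toℕ i))) ≤ P A + P B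
    bound zero          = +-nonneg (P-nonneg FA) (P-nonneg FB)
    bound (suc zero)    = +-monoʳ-≤ (P A) (P-nonneg FB)
    bound (suc (suc n)) = ≤-reflexive (+-congˡ (trans
      (+-congˡ (sum-zero {n} λ _ → P-∅ F-∅ λ ())) (+-identityʳ (P B))))

  P-mono : ∀ {A B} → F A → F B → A ⊆ B → P A ≤ P B
  P-mono {A} {B} FA FB A⊆B = begin
    P A                    ≤⟨ x≤x+y (P-nonneg (F-∖ FB FA)) ⟩
    P A + P (B ∖ A)        ≈⟨ +-congʳ (P-cong FA ((λ a → A⊆B a , a) , proj₂)) ⟩
    P (B ∩ A) + P (B ∖ A)  ≈⟨ P-partition (F-∩ FB FA) (F-∖ FB FA) (∩∖-partition B A) ⟨
    P B                    ∎

  -- Induction on the number of parts: `B zero` is cut out of `A`, and by disjointness the later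
  -- parts meet the remainder exactly where they meet `A`.
  P-parts : ∀ {n} {B : Fin n → Pred Ω 0ℓ} {A} → (∀ i → F (B i)) → Disjoint B → F A →
            P A ≈ sum (λ i → P (B i ∩ A)) + P (A ∖ λ x → ∃[ i ] B i x)
  P-parts {zero}  {B} {A} FB _ FA = trans
    (P-cong FA ((λ a → a , λ ()) , proj₁)) (sym (+-identityˡ _))
  P-parts {suc n} {B} {A} FB dis FA = begin-equality
    P A
      ≈⟨ P-partition (F-∩ FA (FB zero)) FA∖B₀ (∩∖-partition A (B zero)) ⟩
    P (A ∩ B zero) + P (A ∖ B zero)
      ≈⟨ +-cong (P-cong (F-∩ FA (FB zero)) ((λ { (a , b) → b , a }) , λ { (b , a) → a , b }))
                (P-parts (FB ∘ suc) (λ i≢j → dis (i≢j ∘ Finₚ.suc-injective)) FA∖B₀) ⟩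
    P (B zero ∩ A) + (sum (λ i → P (B (suc i) ∩ (A ∖ B zero))) + P ((A ∖ B zero) ∖ λ x → ∃[ i ] B (suc i) x))
      ≈⟨ +-congˡ (+-cong (sum-cong-≋ λ i → P-cong (F-∩ (FB (suc i)) FA∖B₀)
           ((λ { (b , a , _) → b , a }) , λ {x} → λ { (b , a) → b , a , λ b₀ → dis {zero} {suc i} (λ ()) x (b₀ , b) }))
         (P-cong (F-∖ FA∖B₀ (F-∃ (FB ∘ suc)))
           ((λ { ((a , ¬b₀) , ¬b) → a , λ { (zero , b₀) → ¬b₀ b₀ ; (suc i , b) → ¬b (i , b) } }) ,
            λ { (a , ¬b) → (a , λ b₀ → ¬b (zero , b₀)) , λ { (i , b) → ¬b (suc i , b) } }))) ⟩
    P (B zero ∩ A) + (sum (λ i → P (B (suc i) ∩ A)) + P (A ∖ λ x → ∃[ i ] B i x))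
      ≈⟨ +-assoc _ _ _ ⟨
    P (B zero ∩ A) + sum (λ i → P (B (suc i) ∩ A)) + P (A ∖ λ x → ∃[ i ] B i x)
      ∎
    where
    FA∖B₀ : F (A ∖ B zero)
    FA∖B₀ = F-∖ FA (FB zero)

-- Integrals over events as suprema over simple functions.

module SetIntegrals (em : ExcludedMiddle 1ℓ) (ℝ : CompleteOrderedField) {Ω : Set}
                    (𝓟 : Probability.ProbabilitySpace ℝ Ω) where

  open Events em ℝ 𝓟 public
  open SimpleBelow
  open ≤-Reasoning

  -- The integral over `A` of the simple function `s`. Restricting the measure instead of the
  -- function lets the same simple functions serve for every event.
  value∩ : ∀ {X} → Pred Ω 0ℓ → SimpleBelow F X → Carrier
  value∩ A s = sum λ i → coeff s i * P (part s i ∩ A)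

  F-part∩ : ∀ {X A} (s : SimpleBelow F X) → F A → ∀ i → F (part s i ∩ A)
  F-part∩ s FA i = F-∩ (measurable s i) FA

  value∩-partition : ∀ {X D A B} (s : SimpleBelow F X) → F A → F B → Partition D A B →
                     value∩ D s ≈ value∩ A s + value∩ B s
  value∩-partition s FA FB p = trans
    (sum-cong-≋ λ i → trans
      (*-congˡ (P-partition (F-part∩ s FA i) (F-part∩ s FB i) (∩-partition (part s i) p)))
      (distribˡ _ _ _))
    (∑-distrib-+ {size s} _ _)

  value∩-nonneg : ∀ {X A} (s : SimpleBelow F X) → F A → 0# ≤ value∩ A s
  value∩-nonneg s FA = ≤-respˡ-≈ (sum-zero {size s} λ _ → refl)
    (sum-mono-≤ λ i → *-nonneg (proj₁ (positive s i)) (P-nonneg (F-part∩ s FA i)))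

  value∩-null : ∀ {X A} (s : SimpleBelow F X) → F A → P A ≈ 0# → value∩ A s ≈ 0#
  value∩-null s FA PA≈0 = sum-zero λ i → trans
    (*-congˡ (antisym (≤-respʳ-≈ PA≈0 (P-mono (F-part∩ s FA i) FA proj₂)) (P-nonneg (F-part∩ s FA i))))
    (zeroʳ _)

  ∅ₛ : ∀ {X} → SimpleBelow F X
  ∅ₛ = record
    { size = 0 ; part = λ () ; measurable = λ () ; disjoint = λ { {()} }
    ; coeff = λ () ; positive = λ () ; below = λ () }

  -- A simple function is compared with its bound only on its own parts, so once these are cut down
  -- to `A` the inequality on `A` suffices.
  restrict : ∀ {X Y A} → F A → (∀ {x} → A x → X x ≤ Y x) → SimpleBelow F X → SimpleBelow F Y
  restrict {A = A} FA X≤Y s = record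
    { size       = size s
    ; part       = λ i → part s i ∩ A
    ; measurable = F-part∩ s FA
    ; disjoint   = λ { i≢j x ((p , _) , (q , _)) → disjoint s i≢j x (p , q) }
    ; coeff      = coeff s
    ; positive   = positive s
    ; below      = λ { i (p , a) → ≤-trans (below s i p) (X≤Y a) }
    }

  value∩-restrict : ∀ {X Y A D} (FA : F A) (X≤Y : ∀ {x} → A x → X x ≤ Y x) → F D → A ⊆ D →
                    (s : SimpleBelow F X) → value∩ D (restrict {Y = Y} FA X≤Y s) ≈ value∩ A s
  value∩-restrict FA X≤Y FD A⊆D s = sum-cong-≋ λ i → *-congˡ (P-cong
    (F-∩ (F-part∩ s FA i) FD) (proj₁ , λ { (p , a) → (p , a) , A⊆D a }))

  -- The sum of two simple functions with disjoint supports: since no part of one meets a part of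
  -- the other, concatenation preserves the normal form.
  glue : ∀ {X} (s t : SimpleBelow F X) → (∀ i j {x} → part s i x → part t j x → ⊥) → SimpleBelow F X
  glue {X} s t s∩t = record
    { size       = size s ℕ.+ size t
    ; part       = part′ ∘ splitAt (size s)
    ; measurable = λ i → measurable′ (splitAt (size s) i)
    -- Distinct indices stay distinct under `splitAt`, because `join` inverts it.
    ; disjoint   = λ {i} {j} i≢j x → disjoint′ (splitAt (size s) i) (splitAt (size s) j)
        (λ eq → i≢j (≡.trans (≡.sym (Finₚ.join-splitAt (size s) (size t) i))
          (≡.trans (≡.cong (join (size s) (size t)) eq) (Finₚ.join-splitAt (size s) (size t) j)))) x
    ; coeff      = [ coeff s , coeff t ]′ ∘ splitAt (size s)
    ; positive   = λ i → positive′ (splitAt (size s) i)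
    ; below      = λ i → below′ (splitAt (size s) i)
    }
    where
    part′ : Fin (size s) ⊎ Fin (size t) → Pred Ω 0ℓ
    part′ = [ part s , part t ]′

    measurable′ : ∀ k → F (part′ k)
    measurable′ (inj₁ i) = measurable s i
    measurable′ (inj₂ j) = measurable t j

    disjoint′ : ∀ k l → k ≢ l → ∀ x → ¬ (part′ k ∩ part′ l) x
    disjoint′ (inj₁ i) (inj₁ j) k≢l x       = disjoint s (k≢l ∘ ≡.cong inj₁) x
    disjoint′ (inj₁ i) (inj₂ j) k≢l x (p , q) = s∩t i j p q
    disjoint′ (inj₂ i) (inj₁ j) k≢l x (p , q) = s∩t j i q p
    disjoint′ (inj₂ i) (inj₂ j) k≢l x       = disjoint t (k≢l ∘ ≡.cong inj₂) x

    positive′ : ∀ k → 0# < [ coeff s , coeff t ]′ k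
    positive′ (inj₁ i) = positive s i
    positive′ (inj₂ j) = positive t j

    below′ : ∀ k {x} → part′ k x → [ coeff s , coeff t ]′ k ≤ X x
    below′ (inj₁ i) = below s i
    below′ (inj₂ j) = below t j

  value∩-glue : ∀ {X D} (s t : SimpleBelow F X) (s∩t : ∀ i j {x} → part s i x → part t j x → ⊥) →
                value∩ D (glue s t s∩t) ≈ value∩ D s + value∩ D t
  value∩-glue {D = D} s t s∩t =
    sum-splitAt (size s) λ k → [ coeff s , coeff t ]′ k * P ([ part s , part t ]′ k ∩ D)

  module _ {Y : Ω → Carrier} {c : Carrier} where

    -- Truncating at c kills the parts whose coefficient is at most c; their
    -- coefficients are kept only to stay positive.
    lower-coeff : ∀ {a} → Dec (c < a) → Carrier
    lower-coeff {a} (yes _) = a - c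
    lower-coeff {a} (no _)  = a

    -- The positive part of s - c. The condition on the coefficient is built into the part, which
    -- becomes empty when it fails, so the index set remains that of `s`.
    lowerₛ : SimpleBelow F (λ x → c + Y x) → SimpleBelow F Y
    lowerₛ s = record
      { size       = size s
      ; part       = λ i x → part s i x × c < coeff s i
      ; measurable = λ i → measurable′ i (decide (c < coeff s i))
      ; disjoint   = λ { i≢j x ((p , _) , (q , _)) → disjoint s i≢j x (p , q) }
      ; coeff      = λ i → lower-coeff (decide (c < coeff s i))
      ; positive   = λ i → positive′ i (decide (c < coeff s i))
      ; below      = λ { i (p , c<) → below′ i p c< (decide (c < coeff s i)) }
      }
      where
      measurable′ : ∀ i → Dec (c < coeff s i) → F (λ x → part s i x × c < coeff s i)
      measurable′ i (yes c<) = F-resp ((λ p → p , c<) , proj₁) (measurable s i)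
      measurable′ i (no c≮)  = F-resp ((λ ()) , λ { (_ , c<) → contradiction c< c≮ }) F-∅

      positive′ : ∀ i (d : Dec (c < coeff s i)) → 0# < lower-coeff d
      positive′ i (yes c<) = x<y⇒0<y-x c<
      positive′ i (no _)   = positive s i

      below′ : ∀ i {x} → part s i x → c < coeff s i → (d : Dec (c < coeff s i)) → lower-coeff d ≤ Y x
      below′ i p c< (yes _) = x≤y+z⇒x-z≤y (≤-respʳ-≈ (+-comm _ _) (below s i p))
      below′ i p c< (no c≮) = contradiction c< c≮

    -- On each part, `s` is at most c plus its lowered version; the disjoint parts together occupy
    -- at most `P A` inside `A`, so the constant contributes at most `c * P A`.
    value∩-lower : ∀ {A} → F A → 0# ≤ c → (s : SimpleBelow F (λ x → c + Y x)) →
                   value∩ A s ≤ c * P A + value∩ A (lowerₛ s)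
    value∩-lower {A} FA 0≤c s = begin
      value∩ A s
        ≤⟨ sum-mono-≤ (λ i → term i (decide (c < coeff s i))) ⟩
      sum (λ i → c * P (part s i ∩ A) + coeff (lowerₛ s) i * P (part (lowerₛ s) i ∩ A))
        ≈⟨ ∑-distrib-+ {size s} _ _ ⟩
      sum (λ i → c * P (part s i ∩ A)) + value∩ A (lowerₛ s)
        ≈⟨ +-congʳ (*-distribˡ-sum {size s} c _) ⟨
      c * sum (λ i → P (part s i ∩ A)) + value∩ A (lowerₛ s)
        ≤⟨ +-monoˡ-≤ _ (*-monoʳ-≤ 0≤c (≤-respʳ-≈ (sym (P-parts (measurable s) (disjoint s) FA))
             (x≤x+y (P-nonneg (F-∖ FA (F-∃ (measurable s))))))) ⟩
      c * P A + value∩ A (lowerₛ s)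
        ∎
      where
      F-part′ : ∀ i → F (part (lowerₛ s) i ∩ A)
      F-part′ = F-part∩ (lowerₛ s) FA

      term : ∀ i (d : Dec (c < coeff s i)) → coeff s i * P (part s i ∩ A) ≤
             c * P (part s i ∩ A) + lower-coeff d * P (part (lowerₛ s) i ∩ A)
      term i (yes c<) = begin
        coeff s i * P (part s i ∩ A)
          ≈⟨ *-congʳ (//-rightDividesˡ c (coeff s i)) ⟨
        (coeff s i - c + c) * P (part s i ∩ A)
          ≈⟨ *-congʳ (+-comm _ _) ⟩
        (c + (coeff s i - c)) * P (part s i ∩ A)
          ≈⟨ distribʳ _ _ _ ⟩
        c * P (part s i ∩ A) + (coeff s i - c) * P (part s i ∩ A)
          ≈⟨ +-congˡ (*-congˡ (P-cong (F-part∩ s FA i)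
               ((λ { (p , a) → (p , c<) , a }) , λ { ((p , _) , a) → p , a }))) ⟩
        c * P (part s i ∩ A) + (coeff s i - c) * P (part (lowerₛ s) i ∩ A)
          ∎
      term i (no c≮) = begin
        coeff s i * P (part s i ∩ A)
          ≈⟨ *-comm _ _ ⟩
        P (part s i ∩ A) * coeff s i
          ≤⟨ *-monoʳ-≤ (P-nonneg (F-part∩ s FA i)) (≮⇒≥ c≮) ⟩
        P (part s i ∩ A) * c
          ≈⟨ *-comm _ _ ⟩
        c * P (part s i ∩ A)
          ≤⟨ x≤x+y (*-nonneg (proj₁ (positive s i)) (P-nonneg (F-part′ i))) ⟩
        c * P (part s i ∩ A) + coeff s i * P (part (lowerₛ s) i ∩ A)
          ∎

    -- The function c + s on `A`. The extra part `zero` is the portion of `A` that `s` leaves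
    -- uncovered; there the value is c alone, which is below c + Y since Y is nonnegative on `A`.
    raiseₛ : ∀ {A} → F A → (∀ {x} → A x → 0# ≤ Y x) → 0# < c →
             SimpleBelow F Y → SimpleBelow F (λ x → c + Y x)
    raiseₛ {A} FA 0≤Y 0<c s = record
      { size       = suc (size s)
      ; part       = part′
      ; measurable = λ { zero → F-∖ FA (F-∃ (measurable s)) ; (suc i) → F-part∩ s FA i }
      ; disjoint   = λ {i} {j} → disjoint′ i j
      ; coeff      = λ { zero → c ; (suc i) → c + coeff s i }
      ; positive   = λ { zero → 0<c ; (suc i) → <-≤-trans 0<c (x≤x+y (proj₁ (positive s i))) }
      ; below      = λ { zero (a , _) → x≤x+y (0≤Y a) ; (suc i) (p , _) → +-monoʳ-≤ c (below s i p) }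
      }
      where
      part′ : Fin (suc (size s)) → Pred Ω 0ℓ
      part′ zero    = A ∖ λ x → ∃[ i ] part s i x
      part′ (suc i) = part s i ∩ A

      disjoint′ : ∀ i j → i ≢ j → ∀ x → ¬ (part′ i ∩ part′ j) x
      disjoint′ zero    zero    i≢j x _ = i≢j ≡.refl
      disjoint′ zero    (suc j) i≢j x ((_ , ¬p) , (p , _)) = ¬p (j , p)
      disjoint′ (suc i) zero    i≢j x ((p , _) , (_ , ¬p)) = ¬p (i , p)
      disjoint′ (suc i) (suc j) i≢j x ((p , _) , (q , _)) = disjoint s (i≢j ∘ ≡.cong suc) x (p , q)

    -- The constant c is counted once on each part of `s` and once on the uncovered portion; by
    -- `P-parts` these exhaust the mass of `A`.
    value∩-raise : ∀ {A} (FA : F A) (0≤Y : ∀ {x} → A x → 0# ≤ Y x) (0<c : 0# < c) →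
                   (s : SimpleBelow F Y) → value∩ A (raiseₛ FA 0≤Y 0<c s) ≈ c * P A + value∩ A s
    value∩-raise {A} FA 0≤Y 0<c s = begin-equality
      c * P ((A ∖ Z) ∩ A) + sum (λ i → (c + coeff s i) * P ((part s i ∩ A) ∩ A))
        ≈⟨ +-cong (*-congˡ (P-cong (F-∩ F∖ FA) (proj₁ , λ { z@(a , _) → z , a })))
                  (sum-cong-≋ λ i → trans
                    (*-congˡ (P-cong (F-∩ (F-part∩ s FA i) FA) (proj₁ , λ { z@(_ , a) → z , a })))
                    (distribʳ _ _ _)) ⟩
      c * P (A ∖ Z) + sum (λ i → c * P (part s i ∩ A) + coeff s i * P (part s i ∩ A))
        ≈⟨ +-congˡ (∑-distrib-+ {size s} _ _) ⟩
      c * P (A ∖ Z) + (sum (λ i → c * P (part s i ∩ A)) + value∩ A s)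
        ≈⟨ +-assoc _ _ _ ⟨
      c * P (A ∖ Z) + sum (λ i → c * P (part s i ∩ A)) + value∩ A s
        ≈⟨ +-congʳ (+-congˡ (*-distribˡ-sum {size s} c _)) ⟨
      c * P (A ∖ Z) + c * sum (λ i → P (part s i ∩ A)) + value∩ A s
        ≈⟨ +-congʳ (distribˡ c _ _) ⟨
      c * (P (A ∖ Z) + sum (λ i → P (part s i ∩ A))) + value∩ A s
        ≈⟨ +-congʳ (*-congˡ (+-comm _ _)) ⟩
      c * (sum (λ i → P (part s i ∩ A)) + P (A ∖ Z)) + value∩ A s
        ≈⟨ +-congʳ (*-congˡ (P-parts (measurable s) (disjoint s) FA)) ⟨
      c * P A + value∩ A s
        ∎
      where
      Z : Pred Ω 0ℓ
      Z x = ∃[ i ] part s i x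

      F∖ : F (A ∖ Z)
      F∖ = F-∖ FA (F-∃ (measurable s))

  -- v = ∫_A X⁺ dP.
  SetIntegral : (Ω → Carrier) → Pred Ω 0ℓ → Carrier → Set 1ℓ
  SetIntegral X A = IsLub {I = SimpleBelow F X} (value∩ A)

  -- Restriction to `A` turns simple functions below either integrand into ones below the other,
  -- without changing their value on `A`.
  setIntegral-transfer : ∀ {X Y A v} → F A → (∀ {x} → A x → X x ≈ Y x) →
                         SetIntegral X A v → SetIntegral Y A v
  setIntegral-transfer FA X≈Y (upper , least) =
    (λ s → ≤-respˡ-≈ (value∩-restrict FA (≤-reflexive ∘ sym ∘ X≈Y) FA id s)
           (upper (restrict FA (≤-reflexive ∘ sym ∘ X≈Y) s))) ,
    λ u ≤u → least u λ s →
      ≤-respˡ-≈ (value∩-restrict FA (≤-reflexive ∘ X≈Y) FA id s) (≤u (restrict FA (≤-reflexive ∘ X≈Y) s))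

  -- The values over `A` and over `B` are bounded by v, so both suprema exist by completeness.
  -- Splitting one simple function bounds v above; gluing two bounds it below.
  setIntegral-split : ∀ {X D A B v} → F D → F A → F B → Partition D A B → SetIntegral X D v →
                      ∃[ a ] ∃[ b ] SetIntegral X A a × SetIntegral X B b × v ≈ a + b
  setIntegral-split {X} {D} {A} {B} {v} FD FA FB p (upper , least) =
    a , b , intA , intB , antisym
      (least (a + b) λ s → ≤-respˡ-≈ (sym (value∩-partition s FA FB p)) (+-mono-≤ (proj₁ intA s) (proj₁ intB s)))
      -- Two suprema in turn: first over t with s fixed, then over s.
      (x≤z-y⇒x+y≤z (proj₂ intA (v - b) λ s → x+y≤z⇒x≤z-y (≤-respˡ-≈ (+-comm _ _)
        (x≤z-y⇒x+y≤z (proj₂ intB (v - value∩ A s) λ t →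
          x+y≤z⇒x≤z-y (≤-respˡ-≈ (+-comm _ _) (glued s t)))))))
    where
    existsA : ∃ (SetIntegral X A)
    existsA = lub-exists (value∩ A) ∅ₛ v λ s → ≤-trans
      (x≤x+y (value∩-nonneg s FB)) (≤-respˡ-≈ (value∩-partition s FA FB p) (upper s))

    existsB : ∃ (SetIntegral X B)
    existsB = lub-exists (value∩ B) ∅ₛ v λ s → ≤-trans
      (≤-respʳ-≈ (+-comm _ _) (x≤x+y (value∩-nonneg s FA))) (≤-respˡ-≈ (value∩-partition s FA FB p) (upper s))

    a b : Carrier
    a = proj₁ existsA
    b = proj₁ existsB

    intA : SetIntegral X A a
    intA = proj₂ existsA

    intB : SetIntegral X B b
    intB = proj₂ existsB

    glued : ∀ s t → value∩ A s + value∩ B t ≤ v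
    glued s t = ≤-respˡ-≈ (trans (value∩-glue s∣A t∣B s∩t)
      (+-cong (value∩-restrict FA (λ _ → ≤-refl) FD (inˡ p) s) (value∩-restrict FB (λ _ → ≤-refl) FD (inʳ p) t)))
      (upper (glue s∣A t∣B s∩t))
      where
      s∣A t∣B : SimpleBelow F X
      s∣A = restrict FA (λ _ → ≤-refl) s
      t∣B = restrict FB (λ _ → ≤-refl) t
      s∩t : ∀ i j {x} → part s∣A i x → part t∣B j x → ⊥
      s∩t i j (_ , a) (_ , b) = Partition.disjoint p a b

  -- Raising the simple functions below Y shows that `v - c * P A` is an upper bound of their
  -- values; lowering those below c + Y shows that it is the least.
  setIntegral-translate : ∀ {X Y A c v} → F A → 0# ≤ c → (∀ {x} → A x → X x ≈ c + Y x) →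
                          (∀ {x} → A x → 0# ≤ Y x) →
                          SetIntegral X A v → SetIntegral Y A (v - c * P A)
  setIntegral-translate {X} {Y} {A} {c} {v} FA 0≤c X≈c+Y 0≤Y int =
    (λ s → x+y≤z⇒x≤z-y (≤-respˡ-≈ (+-comm _ _) (raised s (decide (0# ≈ c))))) ,
    λ u ≤u → x≤y+z⇒x-z≤y (proj₂ int′ (u + c * P A) λ s → begin
      value∩ A s                      ≤⟨ value∩-lower FA 0≤c s ⟩
      c * P A + value∩ A (lowerₛ s)   ≤⟨ +-monoʳ-≤ _ (≤u (lowerₛ s)) ⟩
      c * P A + u                     ≈⟨ +-comm _ _ ⟩
      u + c * P A                     ∎)
    where
    int′ : SetIntegral (λ x → c + Y x) A v
    int′ = setIntegral-transfer FA X≈c+Y int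

    raised : ∀ s → Dec (0# ≈ c) → c * P A + value∩ A s ≤ v
    raised s (no 0≉c)  = ≤-respˡ-≈ (value∩-raise FA 0≤Y (0≤c , 0≉c) s) (proj₁ int′ (raiseₛ FA 0≤Y (0≤c , 0≉c) s))
    -- For c = 0 the extra part of `raiseₛ` would have a zero coefficient, so `s` itself is used as
    -- a simple function below c + Y on `A`.
    raised s (yes 0≈c) = begin
      c * P A + value∩ A s    ≈⟨ +-congʳ (trans (*-congʳ (sym 0≈c)) (zeroˡ _)) ⟩
      0# + value∩ A s         ≈⟨ +-identityˡ _ ⟩
      value∩ A s              ≈⟨ value∩-restrict FA Y≤c+Y FA id s ⟨
      value∩ A (restrict FA Y≤c+Y s) ≤⟨ proj₁ int′ (restrict FA Y≤c+Y s) ⟩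
      v                       ∎
      where
      Y≤c+Y : ∀ {x} → A x → Y x ≤ c + Y x
      Y≤c+Y _ = ≤-respʳ-≈ (+-comm _ _) (x≤x+y 0≤c)

  -- From expectations to set integrals and on to conditional expectations.

  nonpos⇒part-empty : ∀ {X} → (∀ x → X x ≤ 0#) → (s : SimpleBelow F X) → ∀ i {x} → ¬ part s i x
  nonpos⇒part-empty X≤0 s i {x} p =
    proj₂ (positive s i) (antisym (proj₁ (positive s i)) (≤-trans (below s i p) (X≤0 x)))

  module _ (Q : Pred Ω 0ℓ → Carrier) {X : Ω → Carrier} where

    valueOf : SimpleBelow F X → Carrier
    valueOf s = sum λ i → coeff s i * Q (part s i)

    value≡ : (s : SimpleBelow F X) → value s (fin ∘ Q) ≡ fin (valueOf s)
    value≡ s = sum∞-fin λ i → coeff s i * Q (part s i)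

    integral⁺⇒lub : ∀ {v} → Integral⁺ F (fin ∘ Q) X (fin v) → IsLub valueOf v
    integral⁺⇒lub {v} (upper , least) =
      (λ s → ≡.subst (_≤∞ fin v) (value≡ s) (upper s)) ,
      λ u ≤u → least (fin u) λ s → ≡.subst (_≤∞ fin u) (≡.sym (value≡ s)) (≤u s)

    lub⇒integral⁺ : ∀ {v} → IsLub valueOf v → Integral⁺ F (fin ∘ Q) X (fin v)
    lub⇒integral⁺ {v} (upper , least) =
      (λ s → ≡.subst (_≤∞ fin v) (≡.sym (value≡ s)) (upper s)) ,
      λ { (fin u) ≤u → least u λ s → ≡.subst (_≤∞ fin u) (value≡ s) (≤u s) ; ∞ _ → tt }

    valueOf-nonpos : (∀ {A} → F A → (∀ {x} → ¬ A x) → Q A ≈ 0#) → (∀ x → X x ≤ 0#) →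
                     ∀ s → valueOf s ≈ 0#
    valueOf-nonpos Q-∅ X≤0 s = sum-zero λ i →
      trans (*-congˡ (Q-∅ (measurable s i) (nonpos⇒part-empty X≤0 s i))) (zeroʳ _)

  x⊔0≈x : ∀ {x} → 0# ≤ x → x ⊔ 0# ≈ x
  x⊔0≈x = x≤y⇒y⊔x≈y

  -x⊔0≤0 : ∀ {x} → 0# ≤ x → (- x) ⊔ 0# ≤ 0#
  -x⊔0≤0 0≤x = ≤-reflexive (x≤y⇒x⊔y≈y (0≤x⇒-x≤0 0≤x))

  -- For nonnegative X the negative part vanishes: a simple function below it has only empty parts,
  -- so its integral `q` is zero.
  expectation⇒setIntegral : ∀ {X e} → (∀ x → 0# ≤ X x) → Expectation F P X e →
                            ∃[ p ] SetIntegral X U p × e ≈ p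
  expectation⇒setIntegral {X} {e} 0≤X (p , q , ∫X⁺ , ∫X⁻ , e≈p-q) =
    p ,
    setIntegral-transfer F-U (λ _ → x⊔0≈x (0≤X _)) (lub-cong
      (λ s → sum-cong-≋ λ i → *-congˡ (P-cong (measurable s i) ((_, tt) , proj₁)))
      (integral⁺⇒lub P ∫X⁺)) ,
    trans e≈p-q (trans (+-congˡ (trans (-‿cong q≈0) -0≈0)) (+-identityʳ p))
    where
    q≈0 : q ≈ 0#
    q≈0 = lub-zero ∅ₛ (valueOf-nonpos P P-∅ (-x⊔0≤0 ∘ 0≤X)) (integral⁺⇒lub P ∫X⁻)

  -- Conditioning on `A` divides every value over `A` by `P A`, so E(X ∣ A) is `r * v` and
  -- multiplying by `P A` restores v. If `P A` is zero, all values over `A` vanish, and so does v,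
  -- in agreement with the convention.
  setIntegral⇒condProduct : ∀ {X A v} → F A → (∀ x → 0# ≤ X x) → SetIntegral X A v → CondProduct 𝓟 X A v
  setIntegral⇒condProduct {X} {A} {v} FA 0≤X ∫X with decide (P A ≈ 0#)
  ... | yes PA≈0 = null PA≈0 (lub-zero ∅ₛ (λ s → value∩-null s FA PA≈0) ∫X)
  ... | no  PA≉0 = nonnull PA≉0
    (r * v , 0# ,
     lub⇒integral⁺ P∣A (lub-cong scaled (lub-scale (inverse-nonneg (P-nonneg FA) PA*r≈1) (P-nonneg FA) PA*r≈1
       (setIntegral-transfer FA (λ _ → sym (x⊔0≈x (0≤X _))) ∫X))) ,
     -- The negative part again integrates to zero; `∅ₛ` shows that every upper bound is
     -- nonnegative.
     lub⇒integral⁺ P∣A ((λ s → ≤-reflexive (negative s)) , λ u ≤u → ≤-respˡ-≈ (negative ∅ₛ) (≤u ∅ₛ)) ,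
     sym (trans (+-congˡ -0≈0) (+-identityʳ _)))
    (begin-equality
      v              ≈⟨ *-identityˡ v ⟨
      1# * v         ≈⟨ *-congʳ PA*r≈1 ⟨
      P A * r * v    ≈⟨ *-assoc _ _ _ ⟩
      P A * (r * v)  ≈⟨ *-comm _ _ ⟩
      r * v * P A    ∎)
    where
    r : Carrier
    r = inv (P A) PA≉0

    P∣A : Pred Ω 0ℓ → Carrier
    P∣A = condProb 𝓟 A PA≉0

    PA*r≈1 : P A * r ≈ 1#
    PA*r≈1 = *-inverseʳ (P A) PA≉0

    scaled : ∀ {Y} (s : SimpleBelow F Y) →
             r * value∩ A s ≈ sum (λ i → coeff s i * P∣A (part s i))
    scaled s = trans (*-distribˡ-sum {size s} r _) (sum-cong-≋ {size s} λ i →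
      trans (x*yz≈y*xz _ _ _) (*-congˡ (*-comm _ _)))

    negative : (s : SimpleBelow F (λ x → (- X x) ⊔ 0#)) →
               sum (λ i → coeff s i * P∣A (part s i)) ≈ 0#
    negative = valueOf-nonpos P∣A
      (λ FB ¬B → trans (*-congʳ (P-∅ (F-∩ FB FA) (¬B ∘ proj₁))) (zeroˡ _))
      (-x⊔0≤0 ∘ 0≤X)

-- Peeling off the algorithms one at a time.

module Stages (em : ExcludedMiddle 1ℓ) (ℝ : CompleteOrderedField) {Ω : Set}
              (𝓟 : Probability.ProbabilitySpace ℝ Ω) where

  open SetIntegrals em ℝ 𝓟 public
  open ≤-Reasoning

  -- The events B n and the time T behave like S n and the derived time, but start
  -- from an arbitrary event D in place of Ω, so that the first algorithm can be
  -- removed.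
  record Staged {m : ℕ} (D A₀ : Pred Ω 0ℓ) (B : Fin (1 ℕ.+ m) → Pred Ω 0ℓ)
                (t : Fin (2 ℕ.+ m) → Ω → Carrier) (τ : Fin (1 ℕ.+ m) → Carrier)
                (T : Ω → Carrier) : Set where
    field
      partition  : Partition D A₀ (B zero)
      decreasing : ∀ n → B (suc n) ⊆ B (inject₁ n)
      first      : ∀ {ω} → A₀ ω → T ω ≈ t zero ω
      middle     : ∀ n {ω} → (B (inject₁ n) ∖ B (suc n)) ω →
                   T ω ≈ sum (λ (i : Fin′ (suc n)) → τ (inject i)) + t (inject₁ (suc n)) ω
      last       : ∀ {ω} → B (fromℕ m) ω → T ω ≈ sum τ + t (fromℕ (suc m)) ω

  open Staged

  x≈a+y⇒x-a≈y : ∀ {x a y} → x ≈ a + y → x - a ≈ y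
  x≈a+y⇒x-a≈y {x} {a} {y} x≈a+y =
    trans (+-congʳ (trans x≈a+y (+-comm a y))) (//-rightDividesʳ a y)

  shift : ∀ {x a s u} → x ≈ (a + s) + u → x - a ≈ s + u
  shift x≈ = x≈a+y⇒x-a≈y (trans x≈ (+-assoc _ _ _))

  -- Every sum of limits valid on `B zero` begins with `τ zero`, which is subtracted from `T`. The
  -- middle clause at `zero` has no other limit and becomes the first clause of the tail.
  staged-tail : ∀ {m D A₀ B t τ T} → Staged {suc m} D A₀ B t τ T →
                Staged (B zero) (B zero ∖ B (suc zero)) (B ∘ suc) (t ∘ suc) (τ ∘ suc) (λ ω → T ω - τ zero)
  staged-tail {B = B} st = record
    { partition  = record
      { cover = cover′ ; inˡ = proj₁ ; inʳ = decreasing st zero ; disjoint = λ { (_ , ¬b) b → ¬b b } }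
    ; decreasing = decreasing st ∘ suc
    ; first      = λ b → trans (shift (middle st zero b)) (+-identityˡ _)
    ; middle     = λ n b → shift (middle st (suc n) b)
    ; last       = λ b → shift (last st b)
    }
    where
    cover′ : B zero ⊆ (B zero ∖ B (suc zero)) ∪ B (suc zero)
    cover′ {x} b with decide (B (suc zero) x)
    ... | yes b′ = inj₂ b′
    ... | no ¬b′ = inj₁ (b , ¬b′)

  last₀ : ∀ {D A₀ B t τ T} → Staged {0} D A₀ B t τ T → ∀ {ω} → B zero ω → T ω ≈ τ zero + t (suc zero) ω
  last₀ st b = trans (last st b) (+-congʳ (+-identityʳ _))

  -- On `B zero` the induction runs through the tail: `T` exceeds the nonnegative tail time by
  -- `τ zero`. This supplies the nonnegativity needed for translation and for reading E T as a set
  -- integral.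
  staged-nonneg : ∀ {m D A₀ B t τ T} → (∀ n ω → 0# ≤ t n ω) → (∀ n → 0# ≤ τ n) →
                  Staged {m} D A₀ B t τ T → ∀ {ω} → D ω → 0# ≤ T ω
  staged-nonneg 0≤t 0≤τ st d with cover (partition st) d
  staged-nonneg 0≤t 0≤τ st d | inj₁ a = ≤-respʳ-≈ (sym (first st a)) (0≤t zero _)
  staged-nonneg {zero}  0≤t 0≤τ st d | inj₂ b =
    ≤-respʳ-≈ (sym (last₀ st b)) (+-nonneg (0≤τ zero) (0≤t (suc zero) _))
  staged-nonneg {suc m} 0≤t 0≤τ st d | inj₂ b = ≤-trans (0≤τ zero) (≤-respˡ-≈ (+-identityˡ _)
    (x≤z-y⇒x+y≤z (staged-nonneg (0≤t ∘ suc) (0≤τ ∘ suc) (staged-tail st) b)))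

  -- Bookkeeping for one peeling step: w is the integral of `T` over `B zero`, y is
  -- `τ zero * P (B zero)`, and w - y is the integral of the tail time.
  assemble : ∀ {v a w y x c s} → v ≈ a + w → w - y ≈ x + c + s → v ≈ a + x + c + (y + s)
  assemble {v} {a} {w} {y} {x} {c} {s} v≈ w≈ = begin-equality
    v                          ≈⟨ v≈ ⟩
    a + w                      ≈⟨ +-congˡ (//-rightDividesˡ y w) ⟨
    a + (w - y + y)            ≈⟨ +-congˡ (+-congʳ w≈) ⟩
    a + (x + c + s + y)        ≈⟨ +-congˡ (+-assoc _ _ _) ⟩
    a + (x + c + (s + y))      ≈⟨ +-congˡ (+-congˡ (+-comm s y)) ⟩
    a + (x + c + (y + s))      ≈⟨ +-assoc _ _ _ ⟨
    a + (x + c) + (y + s)      ≈⟨ +-congʳ (+-assoc _ _ _) ⟨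
    a + x + c + (y + s)        ∎

  -- Induction on `m`, with `B zero` taking the place of `D` in the tail. Existence of the
  -- conditional products is inherited from the finite integral over `D`, since each splitting
  -- yields finite integrals.
  staged-integral :
    ∀ {m D A₀ B t τ T v} → F D → F A₀ → (∀ n → F (B n)) →
    (∀ n ω → 0# ≤ t n ω) → (∀ n → 0# ≤ τ n) → Staged {m} D A₀ B t τ T → SetIntegral T D v →
    Σ[ a ∈ Carrier ] Σ[ b ∈ (Fin m → Carrier) ] Σ[ c ∈ Carrier ]
      CondProduct 𝓟 (t zero) A₀ a ×
      (∀ n → CondProduct 𝓟 (t (inject₁ (suc n))) (B (inject₁ n) ∖ B (suc n)) (b n)) ×
      CondProduct 𝓟 (t (fromℕ (suc m))) (B (fromℕ m)) c ×
      v ≈ a + sum b + c + sum (λ n → τ n * P (B n))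
  staged-integral FD FA₀ FB 0≤t 0≤τ st ∫T with setIntegral-split FD FA₀ (FB zero) (partition st) ∫T
  -- With two algorithms there are no middle terms, and what remains on `B zero` after subtracting
  -- `τ zero` is the time of the last algorithm.
  staged-integral {zero} {t = t} FD FA₀ FB 0≤t 0≤τ st _ | a , w , ∫A , ∫B , v≈a+w =
    a , (λ ()) , _ ,
    setIntegral⇒condProduct FA₀ (0≤t zero) (setIntegral-transfer FA₀ (first st) ∫A) ,
    (λ ()) ,
    setIntegral⇒condProduct (FB zero) (0≤t (suc zero))
      (setIntegral-translate (FB zero) (0≤τ zero) (last₀ st) (λ _ → 0≤t (suc zero) _) ∫B) ,
    assemble v≈a+w (sym (trans (+-identityʳ _) (+-identityˡ _)))
  staged-integral {suc m} {B = B} {τ = τ} {T = T} FD FA₀ FB 0≤t 0≤τ st _ | a , w , ∫A , ∫B , v≈a+w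
    with staged-integral (FB zero) (F-∖ (FB zero) (FB (suc zero))) (FB ∘ suc) (0≤t ∘ suc) (0≤τ ∘ suc)
           (staged-tail st)
           (setIntegral-translate (FB zero) (0≤τ zero)
             (λ _ → sym (trans (+-comm _ _) (//-rightDividesˡ (τ zero) _)))
             (staged-nonneg (0≤t ∘ suc) (0≤τ ∘ suc) (staged-tail st)) ∫B)
  ... | a′ , b′ , c , condA′ , condB′ , condC , w≈ =
    -- The first product of the tail becomes the first middle product here.
    a , (λ { zero → a′ ; (suc n) → b′ n }) , c ,
    setIntegral⇒condProduct FA₀ (0≤t zero) (setIntegral-transfer FA₀ (first st) ∫A) ,
    (λ { zero → condA′ ; (suc n) → condB′ n }) ,
    condC ,
    assemble v≈a+w w≈

  -- The radius `x - a` puts the lower end of the interval exactly at `a`.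
  ray-open : ∀ a → Openℝ (a <_)
  ray-open a {x} a<x = x - a , x<y⇒0<y-x a<x ,
    λ y x-ε<y _ → ToStrict.<-respˡ-≈ _≈_ _≤_ trans ≤-respˡ-≈ (x-[x-y]≈y x a) x-ε<y

-- The expected execution time of the derived algorithm.

theorem1 :
    ExcludedMiddle 1ℓ →
    (ℝ : CompleteOrderedField) →
    let open CompleteOrderedField ℝ
        open Probability ℝ
        open Algorithms ℝ
    in
    {Ω Γ : Set} (codeΩ : Ω ↣ ℕ) (codeΓ : Γ ↣ ℕ) →
    (m : ℕ) →
    let N-1 = 1 ℕ.+ m
        N   = 1 ℕ.+ N-1
    in
    (α : Fin N → Algorithm codeΩ codeΓ) →
    (∀ n → Finite (α n)) →
    (∀ i j → Equivalent (α i) (α j)) →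
    (∀ n → ¬ Dominates α n) →
    (𝓟 : ProbabilitySpace Ω) →
    let open ProbabilitySpace 𝓟
        t = λ n → π (α n)
    in
    (∀ n → Measurable F (t n)) →
    (μ : Pred (Vector Carrier N) 0ℓ → ℝ∞) → IsMeasure (Borelℝ^ N) μ →
    (f : Vector Carrier N → Carrier) → IsJointDensity 𝓟 t μ f →
    (τ : Fin N-1 → Carrier) → (∀ n → 0# ≤ τ n) →
    let Sₙ = S t τ in
    (T : Ω → Carrier) → IsDerivedTime t τ T →
    (e : Carrier) → Expectation F P T e →
    Σ[ a ∈ Carrier ] Σ[ b ∈ (Fin m → Carrier) ] Σ[ c ∈ Carrier ]
      CondProduct 𝓟 (t zero) (∁ (Sₙ zero)) a ×
      (∀ n → CondProduct 𝓟 (t (inject₁ (suc n))) (Sₙ (inject₁ n) ∖ Sₙ (suc n)) (b n)) ×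
      CondProduct 𝓟 (t (fromℕ N-1)) (Sₙ (fromℕ m)) c ×
      e ≈ a + sum b + c + sum (λ n → τ n * P (Sₙ n))
theorem1 em ℝ {Ω} codeΩ codeΓ m α _ _ _ 𝓟 t-measurable _ _ _ _ τ 0≤τ T T-derived e E[T]≈e =
  -- The peeling starts from the whole space, with the complement of the first event as the region
  -- where the first algorithm finishes in time.
  let p , ∫T , e≈p = expectation⇒setIntegral (λ _ → staged-nonneg 0≤t 0≤τ staged tt) E[T]≈e
      a , b , c , condA , condB , condC , p≈ =
        staged-integral F-U (F-∁ (F-S zero)) F-S 0≤t 0≤τ staged ∫T
  in  a , b , c , condA , condB , condC , trans e≈p p≈
  where
  open Stages em ℝ 𝓟
  open Algorithms ℝ

  t : Fin (2 ℕ.+ m) → Ω → Carrier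
  t n = π (α n)

  0≤t : ∀ n ω → 0# ≤ t n ω
  0≤t n ω = proj₁ (π-positive (α n) ω)

  F-S : ∀ n → F (S t τ n)
  -- A finite intersection of preimages of open rays.
  F-S n = F-∀ λ i → F-→ (t-measurable (inject₁ i) (generator (ray-open (τ i))))

  cover-U : U ⊆ ∁ (S t τ zero) ∪ S t τ zero
  cover-U {ω} _ with decide (S t τ zero ω)
  ... | yes s = inj₂ s
  ... | no ¬s = inj₁ ¬s

  staged : Staged U (∁ (S t τ zero)) (S t τ) t τ T
  staged = record
    { partition  = record
      { cover = cover-U ; inˡ = λ _ → tt ; inʳ = λ _ → tt ; disjoint = λ ¬s s → ¬s s }
    ; decreasing = λ n s i i≤n → s i (ℕₚ.≤-trans i≤n
        (ℕₚ.≤-trans (ℕₚ.≤-reflexive (Finₚ.toℕ-inject₁ n)) (ℕₚ.n≤1+n _)))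
    ; first      = IsDerivedTime.first T-derived
    ; middle     = IsDerivedTime.middle T-derived
    ; last       = IsDerivedTime.last T-derived
    }
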